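{- The Sperner systems $\mathcal{U}^{2m+1}_1$ and $\mathcal{U}^{2m+1}_2$ are nonisomorphic, and $\mathcal{U}^{2m+2}_1$ and $\mathcal{U}^{2m+2}_2$ are nonisomorphic, for every $m\ge 3$.
   Context: A set system over a finite set $A$ (the ground set) is a set of subsets of $A$, called blocks; it is a Sperner system if no block is included in another. Set systems $\mathcal A$ over $A$ and $\mathcal B$ over $B$ are isomorphic if there is a bijection $\sigma\colon A\to B$ with $\{\sigma(S):S\in\mathcal A\}=\mathcal B$. Let $[m]=\{1,\dots,m\}$. For each $n\in[m]$ let $n'$ be a new element (a primed copy of $n$), and $S'=\{n':n\in S\}$ for $S\subseteq[m]$. Let $E_m=[m]\cup[m]'$, a set with $2m$ elements. Addition of elements of $[m]$ is modulo $m$ with result taken in $[m]$. For $J\subseteq[m]$ let $F^m_J=J\cup([m]\setminus J)'$. Put $\mathcal F^m_1=\{F^m_J: J\subseteq[m],\ |J|\text{ odd}\}$ and $\mathcal F^m_2=\{F^m_J: J\subseteq[m],\ |J|\text{ even}\}$. For $p\in[m]$ let $G^m_p=E_m\setminus\{p,p',(p+1)'\}$ and $\mathcal G^m=\{G^m_p:p\in[m]\}$. For $i\in\{1,2\}$, $\mathcal M^m_i=\mathcal F^m_i\cup\mathcal G^m$, a Sperner system over $E_m$. Let $0,0'$ be two further distinct elements not in $E_m$. For $m\ge3$ and $i\in\{1,2\}$, $\mathcal U^{2m+1}_i=\{S\cup\{0\}:S\in\mathcal M^m_i\}$, a Sperner system over $E_m\cup\{0\}$, and $\mathcal U^{2m+2}_i=\mathcal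 U^{2m+1}_i\cup\{\{0,0'\}\}$, a Sperner system over $E_m\cup\{0,0'\}$. -}

module Defs where

open import Data.Empty using (⊥-elim)
open import Data.Fin using (Fin; zero; suc; toℕ; _↑ˡ_; _↑ʳ_; splitAt)
open import Data.Fin.Properties using (any?; _≟_; ↑ˡ-injective; ↑ʳ-injective; splitAt-↑ˡ; splitAt-↑ʳ)
open import Data.Fin.Subset using (Subset; inside; outside; _∈_; _⊆_; ∁; ⁅_⁆; _∪_; ∣_∣; Nonempty)
open import Data.Fin.Subset.Properties using (_∈?_; ⊆-antisym; drop-∷-⊆; ∁p⊆∁q⇒p⊇q; x∈p⇒x∉∁p; x∈∁p⇒x∉p; x∉p⇒x∈∁p; x∈p∪q⁺; x∈p∪q⁻; x∈⁅x⁆; x∈⁅y⁆⇒x≡y; ∉⊥; drop-there)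
open import Data.Nat using (ℕ; suc; _+_; _≤_; s≤s; z≤n; parity)
open import Data.Nat.DivMod using (_mod_)
open import Data.Parity using (Parity)
open import Data.Product using (Σ; ∃-syntax; _×_; _,_)
open import Data.Sum using (inj₁; inj₂)
open import Data.Vec using (_∷_; _++_; tabulate; here; there)
open import Data.Vec.Properties using ([]=⇒lookup; lookup⇒[]=; lookup-++ˡ; lookup-++ʳ; lookup∘tabulate)
open import Function.Bundles using (_⤖_; Bijection)
open import Level using (0ℓ)
open import Relation.Binary.PropositionalEquality using (_≡_; _≢_; refl; sym; trans; cong)
open import Relation.Nullary using (¬_; Dec; yes; no; does)
open import Relation.Nullary.Decidable using (_×-dec_; dec-true)
open import Relation.Unary using (Pred; _≐_) renaming (_∪_ to _∪ₛ_)

-- The ground set is Fin n. Since `Subset n` is a type of Boolean vectors,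
-- propositional equality of blocks is equality of sets.
SetSystem : ℕ → Set₁
SetSystem n = Pred (Subset n) 0ℓ

Sperner : ∀ {n} → SetSystem n → Set
Sperner 𝒜 = ∀ {S T} → 𝒜 S → 𝒜 T → S ⊆ T → S ≡ T

inImage? : ∀ {m n} (f : Fin m → Fin n) (S : Subset m) (y : Fin n) →
           Dec (∃[ x ] (x ∈ S × f x ≡ y))
inImage? f S y = any? λ x → (x ∈? S) ×-dec (f x ≟ y)

image : ∀ {m n} → (Fin m → Fin n) → Subset m → Subset n
image f S = tabulate λ y → does (inImage? f S y)

imageSystem : ∀ {m n} → (Fin m → Fin n) → SetSystem m → SetSystem n
imageSystem f 𝒜 T = ∃[ S ] (𝒜 S × T ≡ image f S)

Isomorphic : ∀ {m n} → SetSystem m → SetSystem n → Set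
Isomorphic {m} {n} 𝒜 ℬ =
  Σ (Fin m ⤖ Fin n) λ σ → imageSystem (Bijection.to σ) 𝒜 ≐ ℬ

-- `Fin m` stands for [m], the index i standing for the element i + 1.
-- E_m is `Fin (m + m)`: the first m indices are [m], the last m are [m]′.
plain primed : ∀ {m} → Fin m → Fin (m + m)
plain  {m} i = i ↑ˡ m
primed {m} i = m ↑ʳ i

next : ∀ {m} → Fin m → Fin m
next {suc k} i = suc (toℕ i) mod suc k

-- Concatenation is union: J among the plain elements, its complement
-- among the primed ones.
F : ∀ {m} → Subset m → Subset (m + m)
F J = J ++ ∁ J

G : ∀ {m} → Fin m → Subset (m + m)
G p = ∁ (⁅ plain p ⁆ ∪ ⁅ primed p ⁆ ∪ ⁅ primed (next p) ⁆)

-- Families with subscript i ∈ {1,2} are indexed by the parity of i: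
-- 1ℙ gives the subscript 1 (|J| odd), 0ℙ the subscript 2 (|J| even).
𝓕 : (m : ℕ) → Parity → SetSystem (m + m)
𝓕 m i S = ∃[ J ] (parity ∣ J ∣ ≡ i × S ≡ F {m} J)

𝓖 : (m : ℕ) → SetSystem (m + m)
𝓖 m S = ∃[ p ] (S ≡ G {m} p)

𝓜 : (m : ℕ) → Parity → SetSystem (m + m)
𝓜 m i = 𝓕 m i ∪ₛ 𝓖 m

-- U^{2m+1}: index zero is the new element 0, and index suc x is x ∈ E_m.
𝓤-odd : (m : ℕ) → Parity → SetSystem (1 + (m + m))
𝓤-odd m i T = ∃[ S ] (𝓜 m i S × T ≡ inside ∷ S)

-- U^{2m+2}: index zero is 0′, and index suc x is x ∈ E_m ∪ {0}; hence
-- index suc zero is the element 0.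
𝓤-even : (m : ℕ) → Parity → SetSystem (2 + (m + m))
𝓤-even m i = (λ T → ∃[ S ] (𝓤-odd m i S × T ≡ outside ∷ S))
          ∪ₛ (λ T → T ≡ ⁅ suc zero ⁆ ∪ ⁅ zero ⁆)

∈-image⁺ : ∀ {m n} (f : Fin m → Fin n) {S x} → x ∈ S → f x ∈ image f S
∈-image⁺ f {S} {x} x∈S = lookup⇒[]= _ _
  (trans (lookup∘tabulate _ (f x)) (dec-true (inImage? f S (f x)) (x , x∈S , refl)))

∈-image⁻ : ∀ {m n} (f : Fin m → Fin n) {S y} → y ∈ image f S → ∃[ x ] (x ∈ S × f x ≡ y)
∈-image⁻ f {S} {y} y∈ with inImage? f S y | trans (sym (lookup∘tabulate _ y)) ([]=⇒lookup y∈)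
... | yes w | _  = w
... | no _  | ()

plain≢primed : ∀ {m} {i j : Fin m} → plain i ≢ primed j
plain≢primed {m} {i} {j} eq
  with trans (sym (splitAt-↑ˡ m i m)) (trans (cong (splitAt m) eq) (splitAt-↑ʳ m m j))
... | ()

∈-plain⁺ : ∀ {m} {J K : Subset m} {i} → i ∈ J → plain i ∈ (J ++ K)
∈-plain⁺ {_} {J} {K} {i} h = lookup⇒[]= _ _ (trans (lookup-++ˡ J K i) ([]=⇒lookup h))

∈-plain⁻ : ∀ {m} {J K : Subset m} {i} → plain i ∈ (J ++ K) → i ∈ J
∈-plain⁻ {_} {J} {K} {i} h = lookup⇒[]= _ _ (trans (sym (lookup-++ˡ J K i)) ([]=⇒lookup h))

∈-primed⁺ : ∀ {m} {J K : Subset m} {i} → i ∈ K → primed i ∈ (J ++ K)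
∈-primed⁺ {_} {J} {K} {i} h = lookup⇒[]= _ _ (trans (lookup-++ʳ J K i) ([]=⇒lookup h))

∈-primed⁻ : ∀ {m} {J K : Subset m} {i} → primed i ∈ (J ++ K) → i ∈ K
∈-primed⁻ {_} {J} {K} {i} h = lookup⇒[]= _ _ (trans (sym (lookup-++ʳ J K i)) ([]=⇒lookup h))

plain∈G : ∀ {m} {i p : Fin m} → i ≢ p → plain i ∈ G p
plain∈G {m} {i} {p} i≢p = x∉p⇒x∈∁p λ h → go (x∈p∪q⁻ _ _ h)
  where
  go : _ → _
  go (inj₁ h) = i≢p (↑ˡ-injective m _ _ (x∈⁅y⁆⇒x≡y _ h))
  go (inj₂ h) with x∈p∪q⁻ _ _ h
  ... | inj₁ h′ = plain≢primed (x∈⁅y⁆⇒x≡y _ h′)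
  ... | inj₂ h′ = plain≢primed (x∈⁅y⁆⇒x≡y _ h′)

primed∈G : ∀ {m} {i p : Fin m} → i ≢ p → i ≢ next p → primed i ∈ G p
primed∈G {m} {i} {p} i≢p i≢q = x∉p⇒x∈∁p λ h → go (x∈p∪q⁻ _ _ h)
  where
  go : _ → _
  go (inj₁ h) = plain≢primed (sym (x∈⁅y⁆⇒x≡y _ h))
  go (inj₂ h) with x∈p∪q⁻ _ _ h
  ... | inj₁ h′ = i≢p (↑ʳ-injective m _ _ (x∈⁅y⁆⇒x≡y _ h′))
  ... | inj₂ h′ = i≢q (↑ʳ-injective m _ _ (x∈⁅y⁆⇒x≡y _ h′))

plain∉G : ∀ {m} {p : Fin m} → ¬ (plain p ∈ G p)
plain∉G = x∈p⇒x∉∁p (x∈p∪q⁺ (inj₁ (x∈⁅x⁆ _)))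

primed∉G : ∀ {m} {p : Fin m} → ¬ (primed p ∈ G p)
primed∉G = x∈p⇒x∉∁p (x∈p∪q⁺ (inj₂ (x∈p∪q⁺ (inj₁ (x∈⁅x⁆ _)))))

third : ∀ {m} → 3 ≤ m → (a b : Fin m) → ∃[ c ] (c ≢ a × c ≢ b)
third (s≤s (s≤s (s≤s z≤n))) = go
  where
  go : ∀ {k} (a b : Fin (3 + k)) → ∃[ c ] (c ≢ a × c ≢ b)
  go zero          zero          = suc zero , (λ ()) , (λ ())
  go zero          (suc zero)    = suc (suc zero) , (λ ()) , (λ ())
  go zero          (suc (suc _)) = suc zero , (λ ()) , (λ ())
  go (suc zero)    zero          = suc (suc zero) , (λ ()) , (λ ())
  go (suc zero)    (suc _)       = zero , (λ ()) , (λ ())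
  go (suc (suc _)) zero          = suc zero , (λ ()) , (λ ())
  go (suc (suc _)) (suc _)       = zero , (λ ()) , (λ ())

F-injective-⊆ : ∀ {m} {J K : Subset m} → F J ⊆ F K → J ≡ K
F-injective-⊆ {_} {J} {K} h = ⊆-antisym
  (λ x∈J → ∈-plain⁻ {J = K} (h (∈-plain⁺ x∈J)))
  (∁p⊆∁q⇒p⊇q λ x∈ → ∈-primed⁻ {J = K} (h (∈-primed⁺ {J = J} x∈)))

F⊈G : ∀ {m} {J : Subset m} {p} → ¬ (F J ⊆ G p)
F⊈G {_} {J} {p} h with p ∈? J
... | yes p∈J = plain∉G (h (∈-plain⁺ p∈J))
... | no  p∉J = primed∉G (h (∈-primed⁺ {J = J} (x∉p⇒x∈∁p p∉J)))

G⊈F : ∀ {m} → 3 ≤ m → {J : Subset m} {p : Fin m} → ¬ (G p ⊆ F J)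
G⊈F 3≤m {J} {p} h with third 3≤m p (next p)
... | c , c≢p , c≢q = x∈∁p⇒x∉p (∈-primed⁻ {J = J} (h (primed∈G c≢p c≢q)))
                                (∈-plain⁻ (h (plain∈G c≢p)))

G-injective-⊆ : ∀ {m} {p q : Fin m} → G p ⊆ G q → p ≡ q
G-injective-⊆ {_} {p} {q} h with q ≟ p
... | yes q≡p = sym q≡p
... | no  q≢p = ⊥-elim (plain∉G (h (plain∈G q≢p)))

𝓜-sperner : ∀ {m} → 3 ≤ m → ∀ i → Sperner (𝓜 m i)
𝓜-sperner _   _ (inj₁ (J , _ , refl)) (inj₁ (K , _ , refl)) h = cong F (F-injective-⊆ {J = J} {K} h)
𝓜-sperner _   _ (inj₁ (J , _ , refl)) (inj₂ (_ , refl))     h = ⊥-elim (F⊈G {J = J} h)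
𝓜-sperner 3≤m _ (inj₂ (_ , refl))     (inj₁ (J , _ , refl)) h = ⊥-elim (G⊈F 3≤m {J} h)
𝓜-sperner _   _ (inj₂ (_ , refl))     (inj₂ (_ , refl))     h = cong G (G-injective-⊆ h)

𝓜-nonempty : ∀ {m} → 3 ≤ m → ∀ i {S} → 𝓜 m i S → Nonempty S
𝓜-nonempty (s≤s _) _ (inj₁ (J , _ , refl)) with zero ∈? J
... | yes 0∈J = plain zero , ∈-plain⁺ 0∈J
... | no  0∉J = primed zero , ∈-primed⁺ {J = J} (x∉p⇒x∈∁p 0∉J)
𝓜-nonempty 3≤m _ (inj₂ (p , refl)) with third 3≤m p p
... | c , c≢p , _ = plain c , plain∈G c≢p

𝓤-odd-sperner : ∀ {m} → 3 ≤ m → ∀ i → Sperner (𝓤-odd m i)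
𝓤-odd-sperner 3≤m i (_ , S∈ , refl) (_ , T∈ , refl) h =
  cong (inside ∷_) (𝓜-sperner 3≤m i S∈ T∈ (drop-∷-⊆ h))

𝓤-even-sperner : ∀ {m} → 3 ≤ m → ∀ i → Sperner (𝓤-even m i)
𝓤-even-sperner 3≤m i (inj₁ (_ , S∈ , refl)) (inj₁ (_ , T∈ , refl)) h =
  cong (outside ∷_) (𝓤-odd-sperner 3≤m i S∈ T∈ (drop-∷-⊆ h))
𝓤-even-sperner 3≤m i (inj₁ (_ , (_ , S∈ , refl) , refl)) (inj₂ refl) h
  with 𝓜-nonempty 3≤m i S∈
... | x , x∈S with x∈p∪q⁻ _ _ (drop-there (drop-there (h (there (there x∈S)))))
...   | inj₁ x∈⊥ = ⊥-elim (∉⊥ x∈⊥)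
...   | inj₂ x∈⊥ = ⊥-elim (∉⊥ x∈⊥)
𝓤-even-sperner _ _ (inj₂ refl) (inj₁ (_ , _ , refl)) h with h here
... | ()
𝓤-even-sperner _ _ (inj₂ refl) (inj₂ refl) _ = refl

{-# OPTIONS --safe #-}
-- An isomorphism fixes 0, the only element lying in all blocks, and 0′, since
-- {0,0′} is the only block with fewer than three elements; so it restricts to
-- an isomorphism of the systems 𝓜. For m ≥ 4 the blocks G are those that miss
-- exactly three elements; a plain element is missed by one of them and a primed
-- one by two, so plain elements go to plain elements. Then the image of F {p}
-- contains exactly one plain element, which excludes both G q and F K with |K|
-- even. For m = 3 the block {1′,2′,3′} of the even system shares at most one
-- element with each other block, and the odd system has no such block.
module Submission where

open import Defs
import Data.Bool as Bool
open import Data.Empty using (⊥; ⊥-elim)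
open import Data.Fin using (Fin; zero; suc; toℕ; fromℕ; inject₁; punchIn; punchOut; splitAt)
open import Data.Fin.Patterns using (0F; 1F; 2F)
open import Data.Fin.Properties using (_≟_; all?; any?; toℕ<n; toℕ-injective; toℕ-fromℕ; toℕ-fromℕ<; toℕ-inject₁; splitAt-↑ˡ; splitAt-↑ʳ; join-splitAt; ↑ˡ-injective; suc-injective; punchIn-punchOut; punchIn-injective; punchInᵢ≢i)
open import Data.Fin.Subset using (Subset; inside; outside; _∈_; _∉_; ⁅_⁆; ∣_∣; ⊤) renaming (⊥ to ∅)
open import Data.Fin.Subset.Properties using (_∈?_; x∉p⇒x∈∁p; x∈∁p⇒x∉p; x∈p⇒x∉∁p; x∈p∪q⁺; x∈p∪q⁻; ∪-identityˡ; x∈⁅x⁆; x∈⁅y⁆⇒x≡y; ∣⁅x⁆∣≡1; ⊆-antisym; ⊆-reflexive; drop-there; ∉⊥)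
open import Data.Nat using (ℕ; suc; _+_; _%_; _≤_; s≤s; parity)
open import Data.Nat.DivMod using (n%n≡0; m<n⇒m%n≡m)
open import Data.Nat.Properties using (1+n≢n; m≤n⇒m<n∨m≡n; ≤-trans; n≤1+n)
open import Data.Parity using (0ℙ; 1ℙ)
open import Data.Product using (_×_; _,_; proj₁; proj₂; ∃-syntax)
open import Data.Sum using (_⊎_; inj₁; inj₂; [_,_]′)
open import Data.Vec using (_∷_; []; here; there)
open import Data.Vec.Properties using (≡-dec)
open import Function using (id; _∘_)
open import Function.Bundles using (Bijection)
open import Relation.Binary.PropositionalEquality using (_≡_; _≢_; refl; sym; trans; cong; subst)
open import Relation.Nullary using (¬_; Dec; yes; no)
open import Relation.Nullary.Decidable using (from-yes; ¬?; _×-dec_; _→-dec_)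

-- Isomorphisms as pairs of inverse maps

Matches : ∀ {n} → (Fin n → Fin n) → Subset n → Subset n → Set
Matches σ S T = ∀ x → (x ∈ S → σ x ∈ T) × (σ x ∈ T → x ∈ S)

matches-injective : ∀ {n} {σ : Fin n → Fin n} {S S′ T} → Matches σ S T → Matches σ S′ T → S ≡ S′
matches-injective h h′ = ⊆-antisym (λ {x} x∈ → proj₂ (h′ x) (proj₁ (h x) x∈))
                                   (λ {x} x∈ → proj₂ (h x) (proj₁ (h′ x) x∈))

infix 4 _≅_

-- For a bijection `to`, `Matches to S T` makes `T` the image of `S` without computing an image
-- vector. Since the inverse and both directions on blocks are recorded, `≅-sym` only swaps fields,
-- and whatever is proved of `to` applies to `from`.
record _≅_ {n} (𝒜 ℬ : SetSystem n) : Set where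
  field
    to from : Fin n → Fin n
    to∘from : ∀ y → to (from y) ≡ y
    from∘to : ∀ x → from (to x) ≡ x
    forth   : ∀ {S} → 𝒜 S → ∃[ T ] (ℬ T × Matches to S T)
    back    : ∀ {T} → ℬ T → ∃[ S ] (𝒜 S × Matches from T S)

  to≡⇒≡from : ∀ {x y} → to x ≡ y → x ≡ from y
  to≡⇒≡from {x} eq = trans (sym (from∘to x)) (cong from eq)

  from≡⇒≡to : ∀ {x y} → from y ≡ x → y ≡ to x
  from≡⇒≡to {_} {y} eq = trans (sym (to∘from y)) (cong to eq)

  to-injective : ∀ {x y} → to x ≡ to y → x ≡ y
  to-injective {_} {y} eq = trans (to≡⇒≡from eq) (from∘to y)

  from-injective : ∀ {x y} → from x ≡ from y → x ≡ y
  from-injective {_} {y} eq = trans (from≡⇒≡to eq) (to∘from y)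

  flip-to : ∀ {S T} → Matches to S T → Matches from T S
  flip-to h y = (λ y∈ → proj₂ (h (from y)) (subst (_∈ _) (sym (to∘from y)) y∈))
              , (λ fy∈ → subst (_∈ _) (to∘from y) (proj₁ (h (from y)) fy∈))

  flip-from : ∀ {S T} → Matches from T S → Matches to S T
  flip-from h x = (λ x∈ → proj₂ (h (to x)) (subst (_∈ _) (sym (from∘to x)) x∈))
                , (λ tx∈ → subst (_∈ _) (from∘to x) (proj₁ (h (to x)) tx∈))

≅-sym : ∀ {n} {𝒜 ℬ : SetSystem n} → 𝒜 ≅ ℬ → ℬ ≅ 𝒜
≅-sym f = record
  { to = from ; from = to ; to∘from = from∘to ; from∘to = to∘from
  ; forth = back ; back = forth }
  where open _≅_ f

Isomorphic⇒≅ : ∀ {n} {𝒜 ℬ : SetSystem n} → Isomorphic 𝒜 ℬ → 𝒜 ≅ ℬ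
Isomorphic⇒≅ {n} {𝒜} {ℬ} (σ , image⊆ , image⊇) = record
  { to = s ; from = t ; to∘from = st ; from∘to = ts
  ; forth = λ {S} S∈ → image s S , image⊆ (S , S∈ , refl) , matches S
  ; back  = λ T∈ → back (image⊇ T∈)
  }
  where
  s = Bijection.to σ
  t : Fin n → Fin n
  t y = proj₁ (Bijection.surjective σ y)
  st : ∀ y → s (t y) ≡ y
  st y = proj₂ (Bijection.surjective σ y) refl
  ts : ∀ x → t (s x) ≡ x
  ts x = Bijection.injective σ (st (s x))
  matches : ∀ S → Matches s S (image s S)
  matches S x = ∈-image⁺ s , λ sx∈ → let (x′ , x′∈ , eq) = ∈-image⁻ s {S} sx∈
                                     in subst (_∈ S) (Bijection.injective σ eq) x′∈
  back : ∀ {T} → imageSystem s 𝒜 T → ∃[ S ] (𝒜 S × Matches t T S)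
  back (S , S∈ , refl) = S , S∈ , λ y →
    (λ y∈ → proj₂ (matches S (t y)) (subst (_∈ image s S) (sym (st y)) y∈)) ,
    (λ ty∈ → subst (_∈ image s S) (st y) (proj₁ (matches S (t y)) ty∈))

-- Elements and blocks over E_m

plain-or-primed : ∀ {m} (x : Fin (m + m)) → (∃[ i ] x ≡ plain {m} i) ⊎ (∃[ i ] x ≡ primed {m} i)
plain-or-primed {m} x with splitAt m x | join-splitAt m m x
... | inj₁ i | eq = inj₁ (i , sym eq)
... | inj₂ i | eq = inj₂ (i , sym eq)

index : ∀ {m} → Fin (m + m) → Fin m
index {m} x = [ id , id ]′ (splitAt m x)

index-plain : ∀ {m} (i : Fin m) → index (plain i) ≡ i
index-plain {m} i = cong [ id , id ]′ (splitAt-↑ˡ m i m)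

index-primed : ∀ {m} (i : Fin m) → index {m} (primed i) ≡ i
index-primed {m} i = cong [ id , id ]′ (splitAt-↑ʳ m m i)

∈-F⁻ : ∀ {m} (J : Subset m) {i} → plain i ∈ F J → ¬ (primed i ∈ F J)
∈-F⁻ J i∈ i′∈ = x∈∁p⇒x∉p (∈-primed⁻ {J = J} i′∈) (∈-plain⁻ i∈)

∈-G⁺ : ∀ {m} {p : Fin m} {x} → x ≢ plain p → x ≢ primed p → x ≢ primed (next p) → x ∈ G p
∈-G⁺ x≢1 x≢2 x≢3 = x∉p⇒x∈∁p λ h → go (x∈p∪q⁻ _ _ h)
  where
  go : _ → ⊥
  go (inj₁ h) = x≢1 (x∈⁅y⁆⇒x≡y _ h)
  go (inj₂ h) with x∈p∪q⁻ _ _ h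
  ... | inj₁ h′ = x≢2 (x∈⁅y⁆⇒x≡y _ h′)
  ... | inj₂ h′ = x≢3 (x∈⁅y⁆⇒x≡y _ h′)

primed-next∉G : ∀ {m} {p : Fin m} → primed (next p) ∉ G p
primed-next∉G = x∈p⇒x∉∁p (x∈p∪q⁺ (inj₂ (x∈p∪q⁺ (inj₂ (x∈⁅x⁆ _)))))

next-surjective : ∀ {m} → 3 ≤ m → (q : Fin m) → ∃[ r ] (r ≢ q × next r ≡ q)
-- The first index is preceded by the last one, where `next` wraps around; the second `s≤s` makes
-- these two distinct.
next-surjective (s≤s {n = k} (s≤s _)) zero = fromℕ k , (λ ()) , toℕ-injective
  (trans (toℕ-fromℕ< _) (trans (cong (λ t → suc t % suc k) (toℕ-fromℕ k)) (n%n≡0 (suc k))))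
next-surjective (s≤s {n = k} _) (suc j) = inject₁ j
  , (λ eq → 1+n≢n (sym (trans (sym (toℕ-inject₁ j)) (cong toℕ eq))))
  , toℕ-injective (trans (toℕ-fromℕ< _)
      (trans (cong (λ t → suc t % suc k) (toℕ-inject₁ j)) (m<n⇒m%n≡m (s≤s (toℕ<n j)))))

some-index : ∀ {m} → 3 ≤ m → Fin m
some-index (s≤s _) = zero

-- Deleting `a` from the indices leaves at least three, among which `third` avoids what remains of
-- `b` and `c`.
fourth : ∀ {m} → 4 ≤ m → (a b c : Fin m) → ∃[ d ] (d ≢ a × d ≢ b × d ≢ c)
fourth (s≤s {n = k} 3≤k@(s≤s _)) a b c =
  let (b′ , hb) = preimage b
      (c′ , hc) = preimage c
      (d , d≢b′ , d≢c′) = third 3≤k b′ c′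
  in punchIn a d , punchInᵢ≢i a d , d≢b′ ∘ hb d , d≢c′ ∘ hc d
  where
  preimage : ∀ b → ∃[ b′ ] (∀ d → punchIn a d ≡ b → d ≡ b′)
  preimage b with a ≟ b
  -- A default value: `punchIn a` never takes the value `a`, so any index would do.
  ... | yes refl = zero , λ d eq → ⊥-elim (punchInᵢ≢i a d eq)
  ... | no a≢b   = punchOut a≢b ,
    λ d eq → punchIn-injective a _ _ (trans eq (sym (punchIn-punchOut a≢b)))

-- This makes {0,0′} the smallest block of `𝓤-even`, as every other block has 0 and two more
-- elements. `F J` has an element over each index, and `G p` has every plain element except p.
𝓜-two-elements : ∀ {m} → 3 ≤ m → ∀ {i S} → 𝓜 m i S → ∃[ x ] ∃[ y ] (x ≢ y × x ∈ S × y ∈ S)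
𝓜-two-elements {m} (s≤s (s≤s _)) (inj₁ (J , _ , refl)) =
  let (x , x∈ , ix) = element 0F
      (y , y∈ , iy) = element 1F
  in x , y , (λ eq → 0≢1 (trans (sym ix) (trans (cong index eq) iy))) , x∈ , y∈
  where
  0≢1 : 0F ≢ 1F
  0≢1 ()
  element : ∀ i → ∃[ x ] (x ∈ F J × index {m} x ≡ i)
  element i with i ∈? J
  ... | yes i∈ = plain i , ∈-plain⁺ i∈ , index-plain i
  ... | no i∉  = primed i , ∈-primed⁺ {J = J} (x∉p⇒x∈∁p i∉) , index-primed i
𝓜-two-elements {m} 3≤m (inj₂ (p , refl)) =
  let (c , c≢p , _) = third 3≤m p p
      (d , d≢p , d≢c) = third 3≤m p c
  in plain c , plain d , (λ eq → d≢c (sym (↑ˡ-injective m _ _ eq))) , plain∈G c≢p , plain∈G d≢p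

-- Both p and p′ are missed by `G p`, so no element of E_m is universal.
𝓜-misses : ∀ {m} i (x : Fin (m + m)) → ∃[ S ] (𝓜 m i S × x ∉ S)
𝓜-misses {m} i x with plain-or-primed {m} x
... | inj₁ (p , refl) = G p , inj₂ (p , refl) , plain∉G
... | inj₂ (p , refl) = G p , inj₂ (p , refl) , primed∉G

-- Restriction of isomorphisms to 𝓜

Universal : ∀ {n} → SetSystem n → Fin n → Set
Universal 𝒜 x = ∀ {S} → 𝒜 S → x ∈ S

to-universal : ∀ {n} {𝒜 ℬ : SetSystem n} (f : 𝒜 ≅ ℬ) {x} →
               Universal 𝒜 x → Universal ℬ (_≅_.to f x)
to-universal f {x} u T∈ =
  let (S , S∈ , h) = back T∈ in proj₁ (flip-from h x) (u S∈)
  where open _≅_ f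

-- Here `e` embeds E_m in the larger ground set and `lift` adds the new elements to a block. Once
-- both maps preserve the range of `e`, they descend along it.
restrict : ∀ {k n} {𝒜 ℬ : SetSystem n} {𝒜′ ℬ′ : SetSystem k}
  (e : Fin k → Fin n) (lift : Subset k → Subset n) →
  (∀ {x y} → e x ≡ e y → x ≡ y) →
  (∀ {S x} → x ∈ S → e x ∈ lift S) → (∀ {S x} → e x ∈ lift S → x ∈ S) →
  (f : 𝒜 ≅ ℬ) → let open _≅_ f in
  (∀ x → ∃[ y ] to (e x) ≡ e y) → (∀ y → ∃[ x ] from (e y) ≡ e x) →
  (∀ {S} → 𝒜′ S → ∃[ T ] (ℬ′ T × Matches to (lift S) (lift T))) →
  (∀ {T} → ℬ′ T → ∃[ S ] (𝒜′ S × Matches from (lift T) (lift S))) →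
  𝒜′ ≅ ℬ′
restrict e lift e-inj lift⁺ lift⁻ f to-e from-e forth′ back′ = record
  { to = proj₁ ∘ to-e ; from = proj₁ ∘ from-e
  ; to∘from = λ y → e-inj (trans (sym (proj₂ (to-e _)))
                (trans (cong to (sym (proj₂ (from-e y)))) (to∘from (e y))))
  ; from∘to = λ x → e-inj (trans (sym (proj₂ (from-e _)))
                (trans (cong from (sym (proj₂ (to-e x)))) (from∘to (e x))))
  ; forth = λ S∈ → let (T , T∈ , h) = forth′ S∈ in T , T∈ , descend to-e h
  ; back  = λ T∈ → let (S , S∈ , h) = back′ T∈ in S , S∈ , descend from-e h
  }
  where
  open _≅_ f
  descend : ∀ {σ S T} (σ-e : ∀ x → ∃[ y ] σ (e x) ≡ e y) →
            Matches σ (lift S) (lift T) → Matches (proj₁ ∘ σ-e) S T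
  descend σ-e h x =
    (λ x∈ → lift⁻ (subst (_∈ lift _) (proj₂ (σ-e x)) (proj₁ (h (e x)) (lift⁺ x∈)))) ,
    (λ y∈ → lift⁻ (proj₂ (h (e x)) (subst (_∈ lift _) (sym (proj₂ (σ-e x))) (lift⁺ y∈))))

-- Ground set of 𝓤-even: 0′, 0 and the elements of E_m.
pattern 0′  = zero
pattern 0∙  = suc zero
pattern E x = suc (suc x)

module _ {m : ℕ} where

  𝓤-odd-universal : ∀ {i} → Universal (𝓤-odd m i) zero
  𝓤-odd-universal (_ , _ , refl) = here

  𝓤-odd-universal⁻ : ∀ {i x} → Universal (𝓤-odd m i) x → x ≡ zero
  𝓤-odd-universal⁻ {_} {zero}  _ = refl
  𝓤-odd-universal⁻ {i} {suc x} u =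
    let (S , S∈ , x∉) = 𝓜-misses {m} i x
    in ⊥-elim (x∉ (drop-there (u (S , S∈ , refl))))

  𝓤-odd⇒𝓜 : ∀ {i j} → 𝓤-odd m i ≅ 𝓤-odd m j → 𝓜 m i ≅ 𝓜 m j
  𝓤-odd⇒𝓜 f = restrict suc (inside ∷_) suc-injective there drop-there f
      (to-suc f) (to-suc (≅-sym f)) (forth′ f) (forth′ (≅-sym f))
    where
    to-zero : ∀ {i j} (f : 𝓤-odd m i ≅ 𝓤-odd m j) → _≅_.to f zero ≡ zero
    to-zero f = 𝓤-odd-universal⁻ (to-universal f 𝓤-odd-universal)

    to-suc : ∀ {i j} (f : 𝓤-odd m i ≅ 𝓤-odd m j) x → ∃[ y ] _≅_.to f (suc x) ≡ suc y
    to-suc f x with _≅_.to f (suc x) in eq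
    ... | suc y = y , refl
    ... | zero with _≅_.to-injective f (trans eq (sym (to-zero f)))
    ...   | ()

    forth′ : ∀ {i j} (f : 𝓤-odd m i ≅ 𝓤-odd m j) {S} → 𝓜 m i S →
             ∃[ T ] (𝓜 m j T × Matches (_≅_.to f) (inside ∷ S) (inside ∷ T))
    forth′ f S∈ with _≅_.forth f (_ , S∈ , refl)
    ... | _ , (T , T∈ , refl) , h = T , T∈ , h

  -- The union defining {0,0′} computes to this vector except for a tail `∅ ∪ ∅`, which is stuck for
  -- variable `m`.
  𝓤-even-pair : ∀ {i} → 𝓤-even m i (inside ∷ inside ∷ ∅)
  𝓤-even-pair = inj₂ (cong (λ S → inside ∷ inside ∷ S) (sym (∪-identityˡ ∅)))

  𝓤-even-split : ∀ {i T} → 𝓤-even m i T →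
    (∃[ S ] (𝓜 m i S × T ≡ outside ∷ inside ∷ S)) ⊎ (T ≡ inside ∷ inside ∷ ∅)
  𝓤-even-split (inj₁ (_ , (S , S∈ , refl) , refl)) = inj₁ (S , S∈ , refl)
  𝓤-even-split (inj₂ refl) = inj₂ (cong (λ S → inside ∷ inside ∷ S) (∪-identityˡ ∅))

  𝓜⇒𝓤-even : ∀ {i S} → 𝓜 m i S → 𝓤-even m i (outside ∷ inside ∷ S)
  𝓜⇒𝓤-even S∈ = inj₁ (_ , (_ , S∈ , refl) , refl)

  𝓤-even-universal : ∀ {i} → Universal (𝓤-even m i) 0∙
  𝓤-even-universal T∈ with 𝓤-even-split T∈
  ... | inj₁ (_ , _ , refl) = there here
  ... | inj₂ refl           = there here

  module _ (3≤m : 3 ≤ m) where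

    𝓤-even-universal⁻ : ∀ {i x} → Universal (𝓤-even m i) x → x ≡ 0∙
    𝓤-even-universal⁻ {i} {0′} u with u (𝓜⇒𝓤-even (inj₂ (some-index 3≤m , refl)))
    ... | ()
    𝓤-even-universal⁻ {_} {0∙} _ = refl
    𝓤-even-universal⁻ {i} {E x} u =
      let (S , S∈ , x∉) = 𝓜-misses {m} i x
      in ⊥-elim (x∉ (drop-there (drop-there (u (𝓜⇒𝓤-even S∈)))))

    𝓤-even⇒𝓜 : ∀ {i j} → 𝓤-even m i ≅ 𝓤-even m j → 𝓜 m i ≅ 𝓜 m j
    𝓤-even⇒𝓜 f = restrict (λ x → E x) (λ S → outside ∷ inside ∷ S)
        (suc-injective ∘ suc-injective) (there ∘ there) (drop-there ∘ drop-there) f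
        (to-E f) (to-E (≅-sym f)) (forth′ f) (forth′ (≅-sym f))
      where
      to-0∙ : ∀ {i j} (f : 𝓤-even m i ≅ 𝓤-even m j) → _≅_.to f 0∙ ≡ 0∙
      to-0∙ f = 𝓤-even-universal⁻ (to-universal f 𝓤-even-universal)

      -- If {0,0′} matched some S ∪ {0}, two distinct elements of S would both come from 0′, because
      -- 0 comes from 0. So {0,0′} matches itself, and 0′ cannot go to 0.
      to-0′ : ∀ {i j} (f : 𝓤-even m i ≅ 𝓤-even m j) → _≅_.to f 0′ ≡ 0′
      to-0′ f with _≅_.forth f 𝓤-even-pair
      ... | T , T∈ , h with 𝓤-even-split T∈
      ...   | inj₁ (S , S∈ , refl) =
        let (x , y , x≢y , x∈ , y∈) = 𝓜-two-elements 3≤m S∈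
        in ⊥-elim (x≢y (suc-injective (suc-injective
             (from-injective (trans (from≡0′ x∈) (sym (from≡0′ y∈)))))))
        where
        open _≅_ f
        from≡0′ : ∀ {x} → x ∈ S → from (E x) ≡ 0′
        from≡0′ {x} x∈ with from (E x) in eq | proj₁ (flip-to h (E x)) (there (there x∈))
        ... | 0′  | _ = refl
        ... | 0∙  | _ with trans (from≡⇒≡to eq) (to-0∙ f)
        ...   | ()
        from≡0′ {x} x∈ | E _ | there (there z∈) = ⊥-elim (∉⊥ z∈)
      to-0′ f | T , T∈ , h | inj₂ refl with _≅_.to f 0′ in eq | proj₁ (h 0′) here
      ... | 0′  | _ = refl
      ... | 0∙  | _ with _≅_.to-injective f (trans eq (sym (to-0∙ f)))
      ...   | ()
      to-0′ f | T , T∈ , h | inj₂ refl | E _ | there (there z∈) = ⊥-elim (∉⊥ z∈)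

      to-E : ∀ {i j} (f : 𝓤-even m i ≅ 𝓤-even m j) x → ∃[ y ] _≅_.to f (E x) ≡ E y
      to-E f x with _≅_.to f (E x) in eq
      ... | E y = y , refl
      ... | 0′ with _≅_.to-injective f (trans eq (sym (to-0′ f)))
      ...   | ()
      to-E f x | 0∙ with _≅_.to-injective f (trans eq (sym (to-0∙ f)))
      ...   | ()

      forth′ : ∀ {i j} (f : 𝓤-even m i ≅ 𝓤-even m j) {S} → 𝓜 m i S →
               ∃[ T ] (𝓜 m j T × Matches (_≅_.to f) (outside ∷ inside ∷ S) (outside ∷ inside ∷ T))
      forth′ f S∈ with _≅_.forth f (𝓜⇒𝓤-even S∈)
      ... | T , T∈ , h with 𝓤-even-split T∈
      ...   | inj₁ (T′ , T′∈ , refl) = T′ , T′∈ , h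
      -- The pair contains 0′, the image of 0′, so the original block would contain it too.
      ...   | inj₂ refl with proj₂ (h 0′) (subst (_∈ _) (sym (to-0′ f)) here)
      ...     | ()

-- The case m ≥ 4

module _ {m : ℕ} (4≤m : 4 ≤ m) where

  private
    3≤m : 3 ≤ m
    3≤m = ≤-trans (n≤1+n 3) 4≤m

  -- If the match of G p were F J, then an index d other than those of the three
  -- images of the elements missed by G p would give both d and d′ in F J.
  forth-G : ∀ {i j} (f : 𝓜 m i ≅ 𝓜 m j) p →
            ∃[ q ] Matches (_≅_.to f) (G p) (G q)
  forth-G f p with _≅_.forth f (inj₂ (p , refl))
  ... | _ , inj₂ (q , refl) , h = q , h
  ... | _ , inj₁ (J , _ , refl) , h =
    let (d , d≢1 , d≢2 , d≢3) =
          fourth 4≤m (index (to (plain p))) (index (to (primed p))) (index (to (primed (next p))))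
        hit : ∀ x → index x ≡ d → x ∈ F J
        hit x ix = proj₂ (flip-to h x) (∈-G⁺
          (λ eq → d≢1 (trans (sym ix) (cong index (from≡⇒≡to eq))))
          (λ eq → d≢2 (trans (sym ix) (cong index (from≡⇒≡to eq))))
          (λ eq → d≢3 (trans (sym ix) (cong index (from≡⇒≡to eq)))))
    in ⊥-elim (∈-F⁻ J (hit (plain d) (index-plain d)) (hit (primed d) (index-primed d)))
    where open _≅_ f

  -- A primed image q′ would be missed by G q and by G r with r + 1 = q, and both
  -- would correspond to the only G that misses p.
  to-plain : ∀ {i j} (f : 𝓜 m i ≅ 𝓜 m j) p → ∃[ q ] _≅_.to f (plain p) ≡ plain q
  to-plain f p with plain-or-primed {m} (_≅_.to f (plain p))
  ... | inj₁ w = w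
  ... | inj₂ (q , eq) =
    let (r , r≢q , r⁺≡q) = next-surjective 3≤m q
        hq = from-G≡ q primed∉G
        hr = from-G≡ r (subst (λ t → primed t ∉ G r) r⁺≡q primed-next∉G)
    in ⊥-elim (r≢q (G-injective-⊆ (⊆-reflexive (matches-injective hr hq))))
    where
    open _≅_ f
    from-G≡ : ∀ s → primed q ∉ G s → Matches from (G s) (G p)
    from-G≡ s q∉ with forth-G (≅-sym f) s
    ... | a , h with p ≟ a
    ...   | yes refl = h
    ...   | no p≢a =
      ⊥-elim (q∉ (subst (_∈ G s) eq (proj₁ (flip-from h (plain p)) (plain∈G p≢a))))

  𝓜-≇ : ¬ (𝓜 m 1ℙ ≅ 𝓜 m 0ℙ)
  𝓜-≇ f = go (forth (inj₁ (⁅ p ⁆ , cong parity (∣⁅x⁆∣≡1 p) , refl)))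
    where
    open _≅_ f
    p = some-index 3≤m
    q = proj₁ (to-plain f p)
    -- By `to-plain` for the inverse, a plain element of `T` comes from a plain element of
    -- `F ⁅ p ⁆`, and p is the only one.
    ∈⇒≡ : ∀ {T} → Matches to (F ⁅ p ⁆) T → ∀ {y} → plain y ∈ T → y ≡ q
    ∈⇒≡ h {y} y∈ with to-plain (≅-sym f) y | proj₁ (flip-to h (plain y)) y∈
    ... | r , eq | fy∈ with x∈⁅y⁆⇒x≡y p (∈-plain⁻ (subst (_∈ F ⁅ p ⁆) eq fy∈))
    ...   | refl = ↑ˡ-injective m _ _ (trans (from≡⇒≡to eq) (proj₂ (to-plain f p)))

    go : ∃[ T ] (𝓜 m 0ℙ T × Matches to (F ⁅ p ⁆) T) → ⊥
    go (_ , inj₁ (K , even , refl) , h)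
      with trans (sym even) (cong parity (trans (cong ∣_∣ K≡⁅q⁆) (∣⁅x⁆∣≡1 q)))
      where
      q∈K : q ∈ K
      q∈K = ∈-plain⁻ (subst (_∈ F K) (proj₂ (to-plain f p)) (proj₁ (h (plain p)) (∈-plain⁺ (x∈⁅x⁆ p))))
      K≡⁅q⁆ : K ≡ ⁅ q ⁆
      K≡⁅q⁆ = ⊆-antisym
        (λ y∈ → subst (_∈ ⁅ q ⁆) (sym (∈⇒≡ h (∈-plain⁺ y∈))) (x∈⁅x⁆ q))
        (λ y∈ → subst (_∈ K) (sym (x∈⁅y⁆⇒x≡y q y∈)) q∈K)
    ... | ()
    -- Since `m` is at least 3, `G r` has a plain element other than that of index `q`.
    go (_ , inj₂ (r , refl) , h) =
      let (c , c≢r , c≢q) = third 3≤m r q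
      in c≢q (∈⇒≡ h (plain∈G c≢r))

-- The case m = 3

Overlap : Subset 6 → Subset 6 → Set
Overlap S T = T ≢ S × ∃[ x ] ∃[ y ] (x ≢ y × (x ∈ S × y ∈ S) × (x ∈ T × y ∈ T))

overlap? : ∀ S T → Dec (Overlap S T)
overlap? S T = ¬? (≡-dec Bool._≟_ T S) ×-dec any? λ x → any? λ y →
  ¬? (x ≟ y) ×-dec ((x ∈? S) ×-dec (y ∈? S)) ×-dec ((x ∈? T) ×-dec (y ∈? T))

-- The block {1,2,3} shares two plain elements with every `G p`; the other odd blocks `F J` have a
-- single plain element and are treated below.
odd-overlap : ∀ {S} → 𝓜 3 1ℙ S → ∃[ T ] (𝓜 3 1ℙ T × Overlap S T)
odd-overlap (inj₁ (J , odd , refl)) = let (p , o) = go J odd in G {3} p , inj₂ (p , refl) , o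
  where
  go : (J : Subset 3) → parity ∣ J ∣ ≡ 1ℙ → ∃[ p ] Overlap (F J) (G {3} p)
  go J@(inside  ∷ inside  ∷ inside  ∷ []) _ = 0F , from-yes (overlap? (F J) (G {3} 0F))
  -- With J = {i}, the choice p = i - 1 (cyclically) gives the common elements i and (i + 1)′.
  go J@(inside  ∷ outside ∷ outside ∷ []) _ = 2F , from-yes (overlap? (F J) (G {3} 2F))
  go J@(outside ∷ inside  ∷ outside ∷ []) _ = 0F , from-yes (overlap? (F J) (G {3} 0F))
  go J@(outside ∷ outside ∷ inside  ∷ []) _ = 1F , from-yes (overlap? (F J) (G {3} 1F))
  go (inside  ∷ inside  ∷ outside ∷ []) ()
  go (inside  ∷ outside ∷ inside  ∷ []) ()
  go (outside ∷ inside  ∷ inside  ∷ []) ()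
  go (outside ∷ outside ∷ outside ∷ []) ()
odd-overlap (inj₂ (p , refl)) =
  F {3} ⊤ , inj₁ (⊤ , refl , refl) , from-yes (all? λ p → overlap? (G {3} p) (F {3} ⊤)) p

AtMostOnePrimed : Subset 6 → Set
AtMostOnePrimed T = ∀ a b → primed {3} a ∈ T → primed {3} b ∈ T → a ≡ b

atMostOnePrimed? : ∀ T → Dec (AtMostOnePrimed T)
atMostOnePrimed? T = all? λ a → all? λ b →
  (primed {3} a ∈? T) →-dec ((primed {3} b ∈? T) →-dec (a ≟ b))

-- Primed elements are the elements of `F ∅` = {1′,2′,3′}. If |J| = 2, the complement of `J` gives
-- one of them; `G p` has only (p + 2)′.
even-primed : ∀ {T} → 𝓜 3 0ℙ T → T ≢ F {3} ∅ → AtMostOnePrimed T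
even-primed (inj₁ (J , even , refl)) = go J even
  where
  go : (J : Subset 3) → parity ∣ J ∣ ≡ 0ℙ → F J ≢ F {3} ∅ → AtMostOnePrimed (F J)
  go (outside ∷ outside ∷ outside ∷ []) _ F≢ = ⊥-elim (F≢ refl)
  go J@(inside  ∷ inside  ∷ outside ∷ []) _ _ = from-yes (atMostOnePrimed? (F J))
  go J@(inside  ∷ outside ∷ inside  ∷ []) _ _ = from-yes (atMostOnePrimed? (F J))
  go J@(outside ∷ inside  ∷ inside  ∷ []) _ _ = from-yes (atMostOnePrimed? (F J))
  go (inside  ∷ inside  ∷ inside  ∷ []) ()
  go (inside  ∷ outside ∷ outside ∷ []) ()
  go (outside ∷ inside  ∷ outside ∷ []) ()
  go (outside ∷ outside ∷ inside  ∷ []) ()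
even-primed (inj₂ (p , refl)) _ = from-yes (all? λ p → atMostOnePrimed? (G {3} p)) p

F∅-primed : ∀ {x} → x ∈ F {3} ∅ → ∃[ a ] x ≡ primed {3} a
F∅-primed {x} x∈ with plain-or-primed {3} x
... | inj₁ (_ , refl) = ⊥-elim (∉⊥ (∈-plain⁻ {J = ∅ {3}} x∈))
... | inj₂ w = w

𝓜₃-≇ : ¬ (𝓜 3 1ℙ ≅ 𝓜 3 0ℙ)
𝓜₃-≇ f =
  -- `S` corresponds to {1′,2′,3′}, so the two elements that it shares with `S′` become distinct
  -- primed elements of `T`, the match of `S′`.
  let (S , S∈ , h) = back (inj₁ (∅ , refl , refl))
      (S′ , S′∈ , S′≢S , x , y , x≢y , (x∈S , y∈S) , (x∈S′ , y∈S′)) = odd-overlap S∈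
      (T , T∈ , h′) = forth S′∈
      (a , xa) = F∅-primed (proj₁ (flip-from h x) x∈S)
      (b , yb) = F∅-primed (proj₁ (flip-from h y) y∈S)
      a≡b = even-primed T∈
        (λ T≡F∅ → S′≢S (matches-injective (subst (Matches to _) T≡F∅ h′) (flip-from h)))
        a b (subst (_∈ T) xa (proj₁ (h′ x) x∈S′)) (subst (_∈ T) yb (proj₁ (h′ y) y∈S′))
  in x≢y (to-injective (trans xa (trans (cong (primed {3}) a≡b) (sym yb))))
  where open _≅_ f

-- Conclusion for all m ≥ 3

𝓜-odd≇𝓜-even : ∀ {m} → 3 ≤ m → ¬ (𝓜 m 1ℙ ≅ 𝓜 m 0ℙ)
𝓜-odd≇𝓜-even 3≤m f with m≤n⇒m<n∨m≡n 3≤m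
... | inj₁ 4≤m  = 𝓜-≇ 4≤m f
... | inj₂ refl = 𝓜₃-≇ f

proposition3p18 : (m : ℕ) → 3 ≤ m →
    ¬ Isomorphic (𝓤-odd m 1ℙ) (𝓤-odd m 0ℙ) ×
    ¬ Isomorphic (𝓤-even m 1ℙ) (𝓤-even m 0ℙ)
proposition3p18 m 3≤m =
  𝓜-odd≇𝓜-even 3≤m ∘ 𝓤-odd⇒𝓜 ∘ Isomorphic⇒≅ ,
  𝓜-odd≇𝓜-even 3≤m ∘ 𝓤-even⇒𝓜 3≤m ∘ Isomorphic⇒≅
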